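{- Let $A\subseteq\omega^\omega$ be a $\mathsf{W}$-selfdual set. Then there is a map $\psi:\mathscr{P}(\omega)\to[A]_{\mathsf{W}}$ such that for every $X,Y\subseteq\omega$ $$X\subseteq^*Y\iff\psi(X)\leq_{\mathsf{L}(d_1)}\psi(Y).$$ In particular, $(\mathscr{P}(\omega),\subseteq^*)$ embeds into $\mathrm{Deg}_{\boldsymbol{\Delta}^0_1}(\mathsf{L}(d_1))$ (i.e. there is $\psi:\mathscr{P}(\omega)\to\boldsymbol{\Delta}^0_1$ satisfying the displayed equivalence for all $X,Y\subseteq\omega$), and hence $\mathrm{Deg}_{\boldsymbol{\Delta}^0_1}(\mathsf{L}(d_1))$ contains both antichains of size $2^\omega$ (i.e. there is an injection from $2^\omega$ into $\boldsymbol{\Delta}^0_1$ whose values at distinct points are $\leq_{\mathsf{L}(d_1)}$-incomparable) and infinite descending chains.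
   Context: Base theory: $\mathsf{ZF}+\mathsf{DC}(\mathbb{R})$. $\omega^\omega$ is the Baire space with its product topology and standard metric $d(x,y)=0$ if $x=y$ and $d(x,y)=2^{ -n}$ if $x\neq y$ and $n$ is least with $x(n)\neq y(n)$. The metric $d_1$ on $\omega^\omega$ is defined by: $d_1(x,y)=0$ if $x=y$; $d_1(x,y)=d(x,y)$ if $x(0)=y(0)$; $d_1(x,y)=2-2^{ -(\max\{x(0),y(0)\}-1)}$ if $x(0)\neq y(0)$. $\mathsf{W}$ is the set of continuous functions $\omega^\omega\to\omega^\omega$; $\mathsf{L}(d_1)$ is the set of $f:\omega^\omega\to\omega^\omega$ with $d_1(f(x),f(y))\leq d_1(x,y)$ for all $x,y$. For a set of functions $\mathcal{F}$, $A\leq_{\mathcal{F}}B$ iff $A=f^{ -1}(B)$ for some $f\in\mathcal{F}$; $A\equiv_{\mathcal F}B$ iff $A\leq_{\mathcal F}B\leq_{\mathcal F}A$; $[A]_{\mathcal{F}}=\{B\subseteq\omega^\omega: B\equiv_{\mathcal{F}}A\}$. $A$ is $\mathsf{W}$-selfdual if $A\leq_{\mathsf{W}}\omega^\omega\setminus A$. $\boldsymbol{\Delta}^0_1$ is the collection of clopen subsets of $\omega^\omega$, and $\mathrm{Deg}_{\boldsymbol{\Delta}^0_1}(\mathsf{L}(d_1))$ is the set of $\mathsf{L}(d_1)$-degrees $[A]_{\mathsf{L}(d_1)}$ of clopen sets, partially ordered by the order induced by $\leq_{\mathsf{L}(d_1)}$. For $X,Y\subseteq\omega$, $X\subseteq^*Y$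 iff $X\setminus Y$ is finite. $2^\omega$ is the set of infinite binary sequences. -}

module Defs where

open import Data.List.Base using (List; applyUpTo)
open import Data.List.Properties using (∷-injective; ≡-dec)
import Data.List.Membership.Propositional as List
open import Data.Nat.Base using (ℕ; zero; suc; _⊔_; _∸_; _<_; s≤s)
open import Data.Nat.Properties using (_≟_; <-cmp)
open import Data.Product.Base using (∃; _×_; _,_; proj₁; proj₂)
open import Data.Rational.Base using (ℚ; 0ℚ; ½; _-_; _≤_; _/_; +-*-rawSemiring)
open import Data.Integer.Base using (+_)
open import Algebra.Definitions.RawSemiring +-*-rawSemiring using (_^_)
open import Axiom.UniquenessOfIdentityProofs using (module Decidable⇒UIP)
open import Function.Base using (_∘_)
open import Function.Bundles using (_⇔_)
open import Level using (0ℓ)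
open import Relation.Binary.Core using (Rel)
open import Relation.Binary.Definitions using (_Respects_; _Respects₂_; tri<; tri≈; tri>)
open import Relation.Binary.PropositionalEquality
  using (_≡_; _≢_; _≗_; refl; sym; cong)
open import Relation.Nullary using (¬_; Dec; yes; no; Irrelevant; contradiction)
open import Relation.Unary using (Pred; _∈_; _∉_; _∖_; _≐_)

infix 4 _⊆*_ _≐ᴮ_ _≤[_]_ _≡[_]_
infix 8 _↾_

Baire : Set
Baire = ℕ → ℕ

_↾_ : Baire → (n : ℕ) → List ℕ
x ↾ n = applyUpTo x n

-- The classical base theory.  Excluded middle is assumed for propositions
-- (types with at most one element) only: for arbitrary types, `Dec P` would
-- select an element of every nonempty type, i.e. it would be a form of global
-- choice, which ZF + DC(ℝ) does not provide.  Negated types are propositions,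
-- because ⊥ is proof-irrelevant.

ExcludedMiddle : Set₁
ExcludedMiddle = ∀ {P : Set} → Irrelevant P → Dec P

-- DC(ℝ).  With plain ∃ (which carries its witness) this would be provable, so
-- the classical existential is written ¬ ¬ ∃.

DependentChoice : Set₁
DependentChoice =
  (R : Rel Baire 0ℓ) → R Respects₂ _≗_ →
  (∀ x → ¬ ¬ ∃ λ y → R x y) →
  ¬ ¬ ∃ λ (s : ℕ → Baire) → ∀ n → R (s n) (s (suc n))

-- Equality on the Baire space is pointwise, so its subsets are the predicates
-- invariant under _≗_.

record BaireSet : Set₁ where
  constructor mkSet
  field
    mem     : Pred Baire 0ℓ
    respect : mem Respects _≗_
open BaireSet public

_≐ᴮ_ : Rel BaireSet 0ℓ
A ≐ᴮ B = mem A ≐ mem B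

∁ : BaireSet → BaireSet
∁ A = mkSet (_∉ mem A) λ x≗y x∉A y∈A → x∉A (respect A (sym ∘ x≗y) y∈A)

Open : Pred BaireSet 0ℓ
Open U = ∀ x → x ∈ mem U → ∃ λ n → ∀ y → x ↾ n ≡ y ↾ n → y ∈ mem U

𝚫⁰₁ : Pred BaireSet 0ℓ
𝚫⁰₁ A = Open A × Open (∁ A)

-- Maps in the two classes W and L below automatically preserve _≗_.

FunctionClass : Set₁
FunctionClass = Pred (Baire → Baire) 0ℓ

W : FunctionClass
W f = ∀ x n → ∃ λ m → ∀ y → x ↾ m ≡ y ↾ m → f x ↾ n ≡ f y ↾ n

_≤[_]_ : BaireSet → FunctionClass → BaireSet → Set
A ≤[ F ] B = ∃ λ f → f ∈ F × (∀ x → x ∈ mem A ⇔ f x ∈ mem B)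

_≡[_]_ : BaireSet → FunctionClass → BaireSet → Set
A ≡[ F ] B = A ≤[ F ] B × B ≤[ F ] A

Degree : FunctionClass → BaireSet → Pred BaireSet 0ℓ
Degree F A B = B ≡[ F ] A

SelfDual : FunctionClass → Pred BaireSet 0ℓ
SelfDual F A = A ≤[ F ] ∁ A

-- For predicates on ℕ that need not be decidable, finiteness means being
-- covered by a finite list.

Finite : Pred (Pred ℕ 0ℓ) 0ℓ
Finite P = ∃ λ (ns : List ℕ) → ∀ {n} → n ∈ P → n List.∈ ns

_⊆*_ : Rel (Pred ℕ 0ℓ) 0ℓ
X ⊆* Y = Finite (X ∖ Y)

FirstDifference : Baire → Baire → Pred ℕ 0ℓ
FirstDifference x y n = x ↾ n ≡ y ↾ n × x n ≢ y n

↾-injective : ∀ {x y : Baire} {m n} → m < n → x ↾ n ≡ y ↾ n → x m ≡ y m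
↾-injective {m = zero}  {suc n} _         eq = proj₁ (∷-injective eq)
↾-injective {m = suc m} {suc n} (s≤s m<n) eq =
  ↾-injective m<n (proj₂ (∷-injective eq))

firstDifference-irrelevant : ∀ x y → Irrelevant (∃ (FirstDifference x y))
firstDifference-irrelevant x y (m , eq , x≢y) (n , eq′ , x≢y′) with <-cmp m n
... | tri< m<n _ _  = contradiction (↾-injective m<n eq′) x≢y
... | tri> _ _ n<m  = contradiction (↾-injective n<m eq) x≢y′
... | tri≈ _ refl _ = cong (λ e → m , e , x≢y) (Decidable⇒UIP.≡-irrelevant (≡-dec _≟_) eq eq′)

-- The case distinction defining the metric is not constructive.

module Metric (em : ExcludedMiddle) where

  d : Baire → Baire → ℚ
  d x y with em (firstDifference-irrelevant x y)
  ... | yes (n , _) = ½ ^ n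
  ... | no _        = 0ℚ

  -- The case x = y falls under the first clause, where d x y = 0.

  d₁ : Baire → Baire → ℚ
  d₁ x y with x 0 ≟ y 0
  ... | yes _ = d x y
  ... | no _  = + 2 / 1 - ½ ^ (x 0 ⊔ y 0 ∸ 1)

  L : FunctionClass
  L f = ∀ x y → d₁ (f x) (f y) ≤ d₁ x y

{-# OPTIONS --safe #-}
-- Given a continuous h reducing A to its complement, the join B of A and h⁻¹(A)
-- is Wadge equivalent to A and is reduced to its own complement by the nonexpansive
-- map `flip`, which only changes the head.  Consequently B with k leading
-- coordinates ignored, say B⁽ᵏ⁾, is strictly decreasing in k for nonexpansive
-- reductions: a reduction of B⁽ᵏ⁾ to B⁽ˡ⁾ with l < k, followed by `flip`, gives a
-- contraction E with z ∈ B iff E z ∉ B, which is absurd at its fixed point.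
--
-- ψ X places B⁽ʳ⁾ on the cone of sequences with head n, where r = 2 n or 2 n + 1
-- according to whether n ∈ X.  A d₁-nonexpansive f acts on heads by a map g with
-- g n ≤ n for all n ≥ g 0, so a reduction of ψ X to ψ Y yields X ∖ Y ⊆ [0, g 0).
-- Conversely, if X ∖ Y ⊆ [0, N) then ψ X reduces to ψ Y through a map acting on
-- heads by n ↦ max n N.
module Submission where

open import Defs
open import Data.Bool.Base using (Bool; true; false; if_then_else_)
open import Data.Bool.Properties using () renaming (_≟_ to _≟ᵇ_)
open import Data.Sum.Base using (_⊎_; inj₁; inj₂)
open import Data.Integer.Base using (+_; +<+)
open import Data.List.Base using ([]; _∷_; upTo)
open import Data.List.Extrema.Nat using (max; xs≤max)
open import Data.List.Membership.Propositional.Properties using (∈-upTo⁺)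
open import Data.List.Properties using (∷-injective)
open import Data.List.Relation.Unary.All using (lookup)
open import Data.Nat.Base
  using (ℕ; zero; suc; _+_; _*_; _∸_; _⊔_; _<_; z≤n; s≤s; z<s)
  renaming (_≤_ to _≤ₙ_; _^_ to _^ₙ_)
open import Data.Nat.Binary.Base using (ℕᵇ; 2[1+_]; 1+[2_]; toℕ)
open import Data.Nat.Binary.Properties using (toℕ-injective)
open import Data.Nat.Divisibility using (_∣_; ∣-trans; n∣m*n; ∣m+n∣m⇒∣n; m∣m*n; *-cancelˡ-∣; ∣1⇒≡1)
open import Data.Nat.Properties
open import Data.Product.Base using (∃; Σ-syntax; _×_; _,_; proj₁; proj₂)
open import Data.Rational.Base using (ℚ; 0ℚ; 1ℚ; ½; +-*-rawSemiring)
import Data.Rational.Base as ℚ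
import Data.Rational.Properties as ℚ
open import Algebra.Definitions.RawSemiring +-*-rawSemiring using (_^_)
open import Function.Base using (_∘_; id)
open import Function.Bundles using (_⇔_; mk⇔; module Equivalence)
open import Level using (0ℓ)
open import Relation.Binary.Core using (_Preserves_⟶_)
open import Relation.Binary.PropositionalEquality
  using (_≡_; _≢_; _≗_; refl; sym; trans; cong; cong₂; subst; subst₂; module ≡-Reasoning)
open import Relation.Nullary using (¬_; Dec; yes; no; does; contradiction)
open import Relation.Nullary.Decidable using (decidable-stable)
open import Relation.Unary using (Pred; _∈_; _∉_; _∖_; _≐_)

open Equivalence using (to; from)

infix 4 _≈[_]_
infixr 5 _∷ᴮ_

-- Agreement up to a given length, dropping and padding of sequences.

_≈[_]_ : Baire → ℕ → Baire → Set
x ≈[ n ] y = ∀ i → i < n → x i ≡ y i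

≈⇒↾ : ∀ {x y : Baire} {n} → x ≈[ n ] y → x ↾ n ≡ y ↾ n
≈⇒↾ {n = zero}  _  = refl
≈⇒↾ {n = suc n} eq = cong₂ _∷_ (eq 0 z<s) (≈⇒↾ λ i i<n → eq (suc i) (s≤s i<n))

↾⇒≈ : ∀ {x y : Baire} {n} → x ↾ n ≡ y ↾ n → x ≈[ n ] y
↾⇒≈ {x} {y} eq i i<n = ↾-injective {x} {y} i<n eq

≈-mono : ∀ {x y : Baire} {m n} → m ≤ₙ n → x ≈[ n ] y → x ≈[ m ] y
≈-mono m≤n eq i i<m = eq i (≤-trans i<m m≤n)

head-≈ : ∀ {x y : Baire} → x 0 ≡ y 0 → x ≈[ 1 ] y
head-≈ eq zero    _ = eq
head-≈ eq (suc _) (s≤s ())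

_∷ᴮ_ : ℕ → Baire → Baire
(n ∷ᴮ x) zero    = n
(n ∷ᴮ x) (suc i) = x i

drop : ℕ → Baire → Baire
drop k x i = x (k + i)

pad : ℕ → Baire → Baire
pad zero    x = x
pad (suc k) x = 0 ∷ᴮ pad k x

drop-pad : ∀ k x → drop k (pad k x) ≗ x
drop-pad zero    x i = refl
drop-pad (suc k) x i = drop-pad k x i

≈-∷ᴮ : ∀ {x y : Baire} m {n} → x ≈[ n ] y → m ∷ᴮ x ≈[ suc n ] m ∷ᴮ y
≈-∷ᴮ m eq zero    _         = refl
≈-∷ᴮ m eq (suc i) (s≤s i<n) = eq i i<n

≈-pad : ∀ {x y : Baire} k {n} → x ≈[ n ] y → pad k x ≈[ k + n ] pad k y
≈-pad zero    eq = eq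
≈-pad (suc k) eq = ≈-∷ᴮ 0 (≈-pad k eq)

-- Fixed points of contractions on the Baire space.

module _ (E : Baire → Baire)
         (contraction : ∀ n {x y} → x ≈[ n ] y → E x ≈[ suc n ] E y) where

  private
    iterate : ℕ → Baire
    iterate zero    = λ _ → 0
    iterate (suc n) = E (iterate n)

    step : ∀ n → iterate n ≈[ n ] iterate (suc n)
    step zero    i ()
    step (suc n) = contraction n (step n)

    limit : Baire
    limit k = iterate (suc k) k

    stable : ∀ k d → iterate (d + suc k) k ≡ limit k
    stable k zero    = refl
    stable k (suc d) = trans (sym (step (d + suc k) k (m≤n+m (suc k) d))) (stable k d)

    limit≈ : ∀ n → limit ≈[ n ] iterate n
    limit≈ n k k<n =
      trans (sym (stable k (n ∸ suc k))) (cong (λ m → iterate m k) (m∸n+n≡m k<n))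

  -- Coordinate `k` of the iterates is settled from iterate `suc k` on. Since `limit` agrees with
  -- iterate `k` below `k`, one application of `E` gets coordinate `k` right too.
  fixedPoint : ∃ λ z → E z ≗ z
  fixedPoint = limit , λ k → contraction k (limit≈ k) k (n<1+n k)

-- Continuous maps and preimages of clopen sets.

W⇒cong : ∀ {f} → W f → f Preserves _≗_ ⟶ _≗_
W⇒cong {f} wf {x} {y} x≗y i with wf x (suc i)
... | m , cont = ↾⇒≈ {f x} {f y} (cont y (≈⇒↾ {x} {y} {m} λ j _ → x≗y j)) i (n<1+n i)

W-const : ∀ z → W (λ _ → z)
W-const z x n = 0 , λ _ _ → refl

W-∘ : ∀ {f g} → W f → W g → W (f ∘ g)
W-∘ {g = g} wf wg x n with wf (g x) n
... | m , cont-f with wg x m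
... | k , cont-g = k , λ y eq → cont-f (g y) (cont-g y eq)

W-drop : ∀ k → W (drop k)
W-drop k x n = k + n , λ y eq →
  ≈⇒↾ λ i i<n → ↾⇒≈ {x} {y} eq (k + i) (+-monoʳ-< k i<n)

W-pad : ∀ k → W (pad k)
W-pad k x n = n , λ y eq →
  ≈⇒↾ (≈-mono (m≤n+m n k) (≈-pad k (↾⇒≈ {x} {y} eq)))

-- On the sequences sharing the head of `x` the map is `F (x 0)`; the extra coordinate in `suc m`
-- secures that common head.
W-head : (F : ℕ → Baire → Baire) → (∀ n → W (F n)) → W (λ x → F (x 0) x)
W-head F wF x n with wF (x 0) x n
... | m , cont = suc m , λ y eq →
  trans (cont y (≈⇒↾ (≈-mono (n≤1+n m) (↾⇒≈ {x} {y} eq))))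
        (cong (λ k → F k y ↾ n) (proj₁ (∷-injective eq)))

preimage : (f : Baire → Baire) → W f → BaireSet → BaireSet
preimage f wf A = mkSet (λ x → f x ∈ mem A) λ x≗y → respect A (W⇒cong wf x≗y)

Open-preimage : ∀ {f} {U V : BaireSet} → W f →
                (∀ x → x ∈ mem V ⇔ f x ∈ mem U) → Open U → Open V
Open-preimage {f} wf red openU x x∈V with openU (f x) (to (red x) x∈V)
... | n , nbhd with wf x n
... | m , cont = m , λ y eq → from (red y) (nbhd (f y) (cont y eq))

𝚫⁰₁-≤W : ∀ {A B} → B ≤[ W ] A → 𝚫⁰₁ A → 𝚫⁰₁ B
𝚫⁰₁-≤W {A} {B} (f , wf , red) (openA , openᶜA) =
  Open-preimage {U = A} {B} wf red openA ,
  Open-preimage {U = ∁ A} {∁ B} wf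
    (λ x → mk⇔ (λ x∉B → x∉B ∘ from (red x)) (λ fx∉A → fx∉A ∘ to (red x))) openᶜA

-- Order properties of the values of `d₁`.

<⇒≱ℚ : ∀ {p q} → p ℚ.< q → ¬ q ℚ.≤ p
<⇒≱ℚ p<q q≤p = ℚ.<-irrefl refl (ℚ.<-≤-trans p<q q≤p)

½^-positive : ∀ n → 0ℚ ℚ.< ½ ^ n
½^-positive zero    = ℚ.positive⁻¹ 1ℚ
½^-positive (suc n) =
  ℚ.positive⁻¹ (½ ^ suc n) {{ℚ.pos*pos⇒pos ½ (½ ^ n) {{ℚ.positive (½^-positive n)}}}}

½^-suc-< : ∀ n → ½ ^ suc n ℚ.< ½ ^ n
½^-suc-< n = subst (½ ^ suc n ℚ.<_) (ℚ.*-identityˡ (½ ^ n))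
  (ℚ.*-monoˡ-<-pos (½ ^ n) {{ℚ.positive (½^-positive n)}} ½<1)
  where
  ½<1 : ½ ℚ.< 1ℚ
  ½<1 = ℚ.*<* (+<+ (s≤s (s≤s z≤n)))

½^-antimono-≤ : ∀ {m n} → m ≤ₙ n → ½ ^ n ℚ.≤ ½ ^ m
½^-antimono-≤ {n = zero}  z≤n = ℚ.≤-refl
½^-antimono-≤ {m} {suc n} m≤1+n with m≤n⇒m<n∨m≡n m≤1+n
... | inj₁ (s≤s m≤n) = ℚ.≤-trans (ℚ.<⇒≤ (½^-suc-< n)) (½^-antimono-≤ m≤n)
... | inj₂ refl      = ℚ.≤-refl

½^-antimono-< : ∀ {m n} → m < n → ½ ^ n ℚ.< ½ ^ m
½^-antimono-< {m} m<n = ℚ.≤-<-trans (½^-antimono-≤ m<n) (½^-suc-< m)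

½^-reflects-≤ : ∀ {m n} → ½ ^ m ℚ.≤ ½ ^ n → n ≤ₙ m
½^-reflects-≤ le = ≮⇒≥ λ m<n → <⇒≱ℚ (½^-antimono-< m<n) le

-- The `d₁`-distance of two sequences with different heads, where `k` is the larger head minus one.
gap : ℕ → ℚ
gap k = + 2 ℚ./ 1 ℚ.- ½ ^ k

gap-mono-≤ : ∀ {m n} → m ≤ₙ n → gap m ℚ.≤ gap n
gap-mono-≤ m≤n = ℚ.+-monoʳ-≤ (+ 2 ℚ./ 1) (ℚ.neg-antimono-≤ (½^-antimono-≤ m≤n))

gap-reflects-≤ : ∀ {m n} → gap m ℚ.≤ gap n → m ≤ₙ n
gap-reflects-≤ {m} {n} le = ≮⇒≥ λ n<m → <⇒≱ℚ
  (ℚ.+-monoʳ-< (+ 2 ℚ./ 1) {ℚ.- ½ ^ n} {ℚ.- ½ ^ m} (ℚ.neg-antimono-< (½^-antimono-< n<m))) le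

1≤gap : ∀ k → 1ℚ ℚ.≤ gap k
1≤gap k = gap-mono-≤ {0} {k} z≤n

-- Combinatorial form of nonexpansiveness for `d₁`.

module NonexpansiveMaps (em : ExcludedMiddle) where
  open Metric em

  d≤½^ : ∀ {x y} n → x ≈[ n ] y → d x y ℚ.≤ ½ ^ n
  d≤½^ {x} {y} n x≈y with em (firstDifference-irrelevant x y)
  ... | yes (m , _ , xm≢ym) = ½^-antimono-≤ (≮⇒≥ (xm≢ym ∘ x≈y m))
  ... | no _                = ℚ.<⇒≤ (½^-positive n)

  noFirstDifference : ∀ {x y} → ¬ ∃ (FirstDifference x y) → ∀ n → x ≈[ n ] y
  noFirstDifference         _  zero    i ()
  noFirstDifference {x} {y} ∄m (suc n) i (s≤s i≤n) with m≤n⇒m<n∨m≡n i≤n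
  ... | inj₁ i<n  = noFirstDifference ∄m n i i<n
  ... | inj₂ refl = decidable-stable (x i ≟ y i) λ xi≢yi →
    ∄m (i , ≈⇒↾ (noFirstDifference ∄m i) , xi≢yi)

  d≤½^⇒≈ : ∀ {x y} n → d x y ℚ.≤ ½ ^ n → x ≈[ n ] y
  d≤½^⇒≈ {x} {y} n le with em (firstDifference-irrelevant x y)
  ... | yes (m , eq , _) = ≈-mono (½^-reflects-≤ le) (↾⇒≈ eq)
  ... | no ∄m            = noFirstDifference ∄m n

  d-mono : ∀ {x y x′ y′} → (∀ n → x ≈[ n ] y → x′ ≈[ n ] y′) → d x′ y′ ℚ.≤ d x y
  d-mono {x} {y} {x′} {y′} pres with em (firstDifference-irrelevant x y)
  ... | yes (n , eq , _) = d≤½^ n (pres n (↾⇒≈ eq))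
  ... | no ∄m with em (firstDifference-irrelevant x′ y′)
  ...   | yes (m , _ , x′≢y′) =
    contradiction (pres (suc m) (noFirstDifference ∄m (suc m)) m (n<1+n m)) x′≢y′
  ...   | no _ = ℚ.≤-refl

  d₁-same : ∀ {x y} → x 0 ≡ y 0 → d₁ x y ≡ d x y
  d₁-same {x} {y} eq with x 0 ≟ y 0
  ... | yes _ = refl
  ... | no x≢y = contradiction eq x≢y

  d₁-diff : ∀ {x y} → x 0 ≢ y 0 → d₁ x y ≡ gap (x 0 ⊔ y 0 ∸ 1)
  d₁-diff {x} {y} neq with x 0 ≟ y 0
  ... | yes x≡y = contradiction x≡y neq
  ... | no _ = refl

  -- With its converses `L⇒prefix` and `L⇒head`, this replaces the metric by two conditions, one for
  -- pairs inside a cone and one for heads.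
  L-intro : ∀ f → (∀ n {x y} → x ≈[ suc n ] y → f x ≈[ suc n ] f y) →
            (∀ x y → f x 0 ≢ f y 0 → f x 0 ⊔ f y 0 ≤ₙ x 0 ⊔ y 0) → L f
  L-intro f prefix head x y with x 0 ≟ y 0 | f x 0 ≟ f y 0
  ... | yes x≡y | no  f≢ = contradiction (prefix 0 {x} {y} (head-≈ x≡y) 0 z<s) f≢
  -- The images are within distance 1, and different heads are at least 1 apart.
  ... | no  x≢y | yes f≡ = ℚ.≤-trans (d≤½^ {f x} {f y} 0 λ _ ()) (1≤gap (x 0 ⊔ y 0 ∸ 1))
  ... | no  x≢y | no  f≢ = gap-mono-≤ (∸-monoˡ-≤ 1 (head x y f≢))
  ... | yes x≡y | yes f≡ = d-mono {x} {y} {f x} {f y} λ { zero    _   i ()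
                                    ; (suc n) x≈y → prefix n x≈y }

  L⇒prefix : ∀ f → L f → ∀ n {x y} → x ≈[ suc n ] y → f x ≈[ suc n ] f y
  L⇒prefix f lf n {x} {y} x≈y =
    d≤½^⇒≈ {f x} {f y} (suc n) (subst (ℚ._≤ ½ ^ suc n) (d₁-same {f x} {f y} f≡) d₁≤)
    where
    d₁≤ : d₁ (f x) (f y) ℚ.≤ ½ ^ suc n
    d₁≤ = ℚ.≤-trans (lf x y)
      (subst (ℚ._≤ ½ ^ suc n) (sym (d₁-same {x} {y} (x≈y 0 z<s))) (d≤½^ (suc n) x≈y))

    f≡ : f x 0 ≡ f y 0
    -- Different heads would put the images at distance at least 1, above `½ ^ suc n`.
    f≡ = decidable-stable (f x 0 ≟ f y 0) λ f≢ → <⇒≱ℚ (½^-antimono-< {0} {suc n} z<s)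
      (ℚ.≤-trans (1≤gap (f x 0 ⊔ f y 0 ∸ 1)) (subst (ℚ._≤ ½ ^ suc n) (d₁-diff {f x} {f y} f≢) d₁≤))

  L⇒head : ∀ f → L f → ∀ x y → f x 0 ≢ f y 0 → f x 0 ⊔ f y 0 ≤ₙ x 0 ⊔ y 0
  L⇒head f lf x y f≢ = ∸1-reflects-≤ {f x 0 ⊔ f y 0} {x 0} {y 0} x≢y
    (gap-reflects-≤ {f x 0 ⊔ f y 0 ∸ 1} {x 0 ⊔ y 0 ∸ 1}
      (subst₂ ℚ._≤_ (d₁-diff {f x} {f y} f≢) (d₁-diff {x} {y} x≢y) (lf x y)))
    where
    x≢y : x 0 ≢ y 0
    x≢y x≡y = f≢ (L⇒prefix f lf 0 {x} {y} (head-≈ x≡y) 0 z<s)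

    -- Truncated subtraction confuses 0 and 1; `m ≢ n` makes the maximum positive and so rules this
    -- out.
    ∸1-reflects-≤ : ∀ {k m n} → m ≢ n → k ∸ 1 ≤ₙ m ⊔ n ∸ 1 → k ≤ₙ m ⊔ n
    ∸1-reflects-≤ {zero}                  _   _  = z≤n
    ∸1-reflects-≤ {suc k} {zero}  {zero}  m≢n _  = contradiction refl m≢n
    ∸1-reflects-≤ {suc k} {zero}  {suc n} _   le = s≤s le
    ∸1-reflects-≤ {suc k} {suc m} {zero}  _   le = s≤s le
    ∸1-reflects-≤ {suc k} {suc m} {suc n} _   le = s≤s le

  L-id : L id
  L-id x y = ℚ.≤-refl

≐ᴮ⇒≤[L] : (em : ExcludedMiddle) → ∀ A B → A ≐ᴮ B → A ≤[ Metric.L em ] B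
≐ᴮ⇒≤[L] em A B (A⊆B , B⊆A) = id , NonexpansiveMaps.L-id em , λ _ → mk⇔ A⊆B B⊆A

-- The number of ignored coordinates on each cone.

module Rank (em : ExcludedMiddle) where

  -- Membership may have many proofs, so excluded middle is applied to its negation, which is a
  -- proposition.
  ∉? : ∀ (X : Pred ℕ 0ℓ) n → Dec (n ∉ X)
  ∉? X n = em λ _ _ → refl

  excess : Pred ℕ 0ℓ → ℕ → ℕ
  excess X n = if does (∉? X n) then 0 else 1

  excess≤1 : ∀ X n → excess X n ≤ₙ 1
  excess≤1 X n with ∉? X n
  ... | yes _ = z≤n
  ... | no _  = ≤-refl

  excess-∈ : ∀ X {n} → n ∈ X → excess X n ≡ 1
  excess-∈ X {n} n∈X with ∉? X n
  ... | yes n∉X = contradiction n∈X n∉X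
  ... | no _    = refl

  excess-mono : ∀ X Y {n} → n ∉ (X ∖ Y) → excess X n ≤ₙ excess Y n
  excess-mono X Y {n} n∉ with ∉? X n | ∉? Y n
  ... | yes _    | _       = z≤n
  ... | no ¬n∉X  | yes n∉Y = contradiction (λ n∈X → n∉ (n∈X , n∉Y)) ¬n∉X
  ... | no _     | no _    = ≤-refl

  excess-∉ : ∀ X {n} → n ∉ X → excess X n ≡ 0
  excess-∉ X {n} n∉X with ∉? X n
  ... | yes _    = refl
  ... | no ¬n∉X = contradiction n∉X ¬n∉X

  rank : Pred ℕ 0ℓ → ℕ → ℕ
  rank X n = n * 2 + excess X n

  -- Consecutive heads are two ranks apart and the excess is at most 1, so the order of the heads
  -- decides for any two sets.
  rank-< : ∀ X Y {m n} → m < n → rank X m < rank Y n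
  rank-< X Y {m} {n} m<n = begin-strict
    m * 2 + excess X m ≤⟨ +-monoʳ-≤ (m * 2) (excess≤1 X m) ⟩
    m * 2 + 1          ≡⟨ +-comm (m * 2) 1 ⟩
    1 + m * 2          <⟨ n<1+n (1 + m * 2) ⟩
    suc m * 2          ≤⟨ *-monoˡ-≤ 2 m<n ⟩
    n * 2              ≤⟨ m≤m+n (n * 2) _ ⟩
    rank Y n           ∎
    where open ≤-Reasoning

  rank-∖ : ∀ X Y {m n} → n ∈ X ∖ Y → m ≤ₙ n → rank Y m < rank X n
  rank-∖ X Y {m} {n} (n∈X , n∉Y) m≤n with m≤n⇒m<n∨m≡n m≤n
  ... | inj₁ m<n = rank-< Y X m<n
  ... | inj₂ refl rewrite excess-∈ X n∈X | excess-∉ Y n∉Y = +-monoʳ-< (n * 2) z<s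

  -- Below `N` the head strictly grows; from `N` on it stays, and `n` lies outside `X ∖ Y`.
  rank-⊔ : ∀ X Y N → (∀ {n} → n ∈ X ∖ Y → n < N) → ∀ n → rank X n ≤ₙ rank Y (n ⊔ N)
  rank-⊔ X Y N bound n with n <? N
  ... | yes n<N = <⇒≤ (rank-< X Y (≤-trans n<N (m≤n⊔m n N)))
  ... | no n≮N rewrite m≥n⇒m⊔n≡m (≮⇒≥ n≮N) = +-monoʳ-≤ (n * 2) (excess-mono X Y (n≮N ∘ bound))

  rank-cong : ∀ {X Y} → X ≐ Y → ∀ n → rank X n ≡ rank Y n
  rank-cong {X} {Y} (X⊆Y , Y⊆X) n = cong (λ e → n * 2 + e) (≤-antisym
    (excess-mono X Y λ { (n∈X , n∉Y) → n∉Y (X⊆Y n∈X) })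
    (excess-mono Y X λ { (n∈Y , n∉X) → n∉X (Y⊆X n∈Y) }))

-- Flipping the head, and bounds for finite sets.

flipHead : ℕ → ℕ
flipHead zero    = 1
flipHead (suc _) = 0

flip : Baire → Baire
flip x = flipHead (x 0) ∷ᴮ drop 1 x

flip-≈ : ∀ {x y} n → x ≈[ n ] y → flip x ≈[ n ] flip y
flip-≈ n eq zero    0<n = cong flipHead (eq 0 0<n)
flip-≈ n eq (suc i) i<n = eq (suc i) i<n

finite⇒bounded : ∀ {P} → Finite P → ∃ λ N → ∀ {n} → n ∈ P → n < N
finite⇒bounded (ns , cover) = suc (max 0 ns) , λ n∈P → s≤s (lookup (xs≤max 0 ns) (cover n∈P))

unbounded⇒¬⊆* : ∀ {X Y} → (∀ k → ∃ λ n → k ≤ₙ n × n ∈ X ∖ Y) → ¬ X ⊆* Y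
unbounded⇒¬⊆* unb X⊆*Y with finite⇒bounded X⊆*Y
... | N , bound with unb N
... | n , N≤n , n∈ = ≤⇒≯ N≤n (bound n∈)

-- The sets `ψ X` attached to a self-dual set.

module Embedding (em : ExcludedMiddle) (A : BaireSet) (h : Baire → Baire) (wh : W h)
                 (dual : ∀ x → x ∈ mem A ⇔ h x ∉ mem A) where
  open Metric em
  open NonexpansiveMaps em
  open Rank em

  branch : ℕ → Baire → Baire
  branch zero    = drop 1
  branch (suc _) = h ∘ drop 1

  W-branch : ∀ n → W (branch n)
  W-branch zero    = W-drop 1
  W-branch (suc _) = W-∘ wh (W-drop 1)

  -- The preimage of `A` under `join` is the set B: head 0 carries `A`, every other head carries the
  -- preimage of `A` under `h`.
  join : Baire → Baire
  join z = branch (z 0) z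

  W-join : W join
  W-join = W-head branch W-branch

  join-respect : ∀ z z′ → z ≗ z′ → join z ∈ mem A → join z′ ∈ mem A
  join-respect z z′ z≗z′ = respect A (W⇒cong W-join z≗z′)

  -- The two cases are `dual` and its contrapositive; the latter is constructive
  -- because x ∈ A is equivalent to a negation.
  flip-dual : ∀ z → join z ∈ mem A ⇔ (join (flip z) ∉ mem A)
  flip-dual z with z 0
  ... | zero  = dual (drop 1 z)
  ... | suc _ = mk⇔ (λ h∈ z∈ → to (dual (drop 1 z)) z∈ h∈)
    λ z∉ → from (dual (h (drop 1 z))) λ hh∈ →
      z∉ (from (dual (drop 1 z)) λ h∈ → to (dual (h (drop 1 z))) h∈ hh∈)

  -- The part of `x` that `ψ X` reads besides the head; `suc` discards the head itself.
  tail : Pred ℕ 0ℓ → Baire → Baire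
  tail X x = drop (suc (rank X (x 0))) x

  W-tail : ∀ X → W (tail X)
  W-tail X = W-head (λ n → drop (suc (rank X n))) λ n → W-drop (suc (rank X n))

  W-join∘tail : ∀ X → W (join ∘ tail X)
  W-join∘tail X = W-∘ W-join (W-tail X)

  ψ : Pred ℕ 0ℓ → BaireSet
  ψ X = preimage (join ∘ tail X) (W-join∘tail X) A

  ψ-transfer : ∀ X Y x y → tail X x ≗ tail Y y → x ∈ mem (ψ X) → y ∈ mem (ψ Y)
  ψ-transfer X Y x y = join-respect (tail X x) (tail Y y)

  ψ-cong : ψ Preserves _≐_ ⟶ _≐ᴮ_
  ψ-cong {X} {Y} X≐Y =
    (λ {x} → ψ-transfer X Y x x (eq x)) , (λ {x} → ψ-transfer Y X x x (sym ∘ eq x))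
    where
    eq : ∀ x → tail X x ≗ tail Y x
    eq x i = cong (λ r → x (suc r + i)) (rank-cong X≐Y (x 0))

  ψ-degree : ∀ X → ψ X ∈ Degree W A
  ψ-degree X =
    (join ∘ tail X , W-join∘tail X , λ _ → mk⇔ id id) ,
    (pad k , W-pad k , λ y →
      mk⇔ (respect A {y} {join (tail X (pad k y))} (sym ∘ eq y))
          (respect A {join (tail X (pad k y))} {y} (eq y)))
    where
    -- One 0 selects the cone of head 0, `rank X 0` zeros are ignored, and a last 0 makes `join`
    -- read the copy of `A`.
    k = suc (suc (rank X 0))

    head-pad : ∀ m y → pad (suc m) y (m + 0) ≡ 0
    head-pad zero    y = refl
    head-pad (suc m) y = head-pad m y

    eq : ∀ y → join (tail X (pad k y)) ≗ y
    eq y i rewrite head-pad (suc (rank X 0)) y | +-suc (rank X 0) i = drop-pad k y i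

  -- From nonexpansive reductions to inclusion modulo finite.

  module _ (X Y : Pred ℕ 0ℓ) (f : Baire → Baire) (lf : L f)
           (red : ∀ x → x ∈ mem (ψ X) ⇔ f x ∈ mem (ψ Y)) where

    -- A right inverse of `tail X` with values in the cone of head `n`.
    cone : ℕ → Baire → Baire
    cone n z = n ∷ᴮ pad (rank X n) z

    -- The action of `f` on heads; by `target-cone` the choice of the zero sequence does not matter.
    target : ℕ → ℕ
    target n = f (cone n (λ _ → 0)) 0

    target-cone : ∀ n z → f (cone n z) 0 ≡ target n
    target-cone n z = L⇒prefix f lf 0 {cone n z} {cone n (λ _ → 0)} (head-≈ refl) 0 z<s

    -- Compare with head 0: if the images have different heads, their maximum is at most `n ⊔ 0`;
    -- otherwise `target n` is `target 0`.
    target-≤ : ∀ {n} → target 0 ≤ₙ n → target n ≤ₙ n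
    target-≤ {n} g0≤n with target n ≟ target 0
    ... | yes eq = subst (_≤ₙ n) (sym eq) g0≤n
    ... | no neq = ≤-trans (m≤m⊔n (target n) (target 0))
      (subst (target n ⊔ target 0 ≤ₙ_) (⊔-identityʳ n)
        (L⇒head f lf (cone n λ _ → 0) (cone 0 λ _ → 0) neq))

    rank-≤-target : ∀ n → rank X n ≤ₙ rank Y (target n)
    rank-≤-target n = ≮⇒≥ absurd
      where
      -- `shadow z` is what `ψ Y` reads of `f (cone n z)`, with the cutoff fixed by `target n` so
      -- that it does not vary with `z`.
      shadow E : Baire → Baire
      shadow z = drop (suc (rank Y (target n))) (f (cone n z))
      E z = flip (shadow z)

      tail-cone : ∀ z → tail X (cone n z) ≗ z
      tail-cone z = drop-pad (rank X n) z

      tail-f : ∀ z → tail Y (f (cone n z)) ≗ shadow z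
      tail-f z i = cong (λ m → drop (suc (rank Y m)) (f (cone n z)) i) (target-cone n z)

      shadow-red : ∀ z → join z ∈ mem A ⇔ join (shadow z) ∈ mem A
      shadow-red z = mk⇔
        (λ z∈ → join-respect _ (shadow z) (tail-f z)
          (to (red (cone n z)) (join-respect z _ (sym ∘ tail-cone z) z∈)))
        (λ z∈ → join-respect _ z (tail-cone z)
          (from (red (cone n z)) (join-respect (shadow z) _ (sym ∘ tail-f z) z∈)))

      noFixedPoint : ∀ z → ¬ E z ≗ z
      noFixedPoint z Ez≗z = ¬¬z∈ z∉
        where
        z∉ : join z ∉ mem A
        z∉ z∈ = to (flip-dual (shadow z)) (to (shadow-red z) z∈)
          (join-respect z (E z) (sym ∘ Ez≗z) z∈)

        ¬¬z∈ : ¬ (join z ∉ mem A)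
        ¬¬z∈ z∉ = z∉ (from (shadow-red z) (from (flip-dual (shadow z))
          (z∉ ∘ join-respect (E z) z Ez≗z)))

      contraction : rank Y (target n) < rank X n → ∀ k {z z′} →
                    z ≈[ k ] z′ → E z ≈[ suc k ] E z′
      contraction r<r′ k {z} {z′} eq = flip-≈ {shadow z} {shadow z′} (suc k) λ i i<1+k →
        -- `f` preserves agreement on `rank X n + k + 1` coordinates; `shadow` drops at most
        -- `rank X n` of them, which leaves `k + 1`.
        L⇒prefix f lf (rank X n + k) {cone n z} {cone n z′} (≈-∷ᴮ n (≈-pad (rank X n) eq))
          (suc (rank Y (target n)) + i)
          (s≤s (+-mono-≤ r<r′ (≤-pred i<1+k)))

      absurd : ¬ rank Y (target n) < rank X n
      absurd r<r′ =
        let z , Ez≗z = fixedPoint E (contraction r<r′) in noFixedPoint z Ez≗z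

    -- From `target 0` on heads do not grow, so a point of `X ∖ Y` there would violate
    -- `rank-≤-target` by `rank-∖`.
    nonexpansive⇒⊆* : X ⊆* Y
    nonexpansive⇒⊆* = upTo (target 0) , λ {n} n∈ → ∈-upTo⁺ (≰⇒> λ g0≤n →
      ≤⇒≯ (rank-≤-target n) (rank-∖ X Y n∈ (target-≤ g0≤n)))

  ψ-reflects : ∀ {X Y} → ψ X ≤[ L ] ψ Y → X ⊆* Y
  ψ-reflects {X} {Y} (f , lf , red) = nonexpansive⇒⊆* X Y f lf red

  -- The target cone ignores at least as many coordinates as the source cone, so delaying the
  -- sequence by the difference aligns the parts that are read.
  ψ-preserves : ∀ {X Y} → X ⊆* Y → ψ X ≤[ L ] ψ Y
  ψ-preserves {X} {Y} X⊆*Y with finite⇒bounded X⊆*Y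
  ... | N , bound = f , L-intro f prefix head , λ x →
    mk⇔ (ψ-transfer X Y x (f x) (sym ∘ tail-f x)) (ψ-transfer Y X (f x) x (tail-f x))
    where
    lag : ℕ → ℕ
    lag n = rank Y (n ⊔ N) ∸ rank X n

    f : Baire → Baire
    f x zero    = x 0 ⊔ N
    -- Up to the lag, truncated subtraction falls back on `x 0`; these positions are at most
    -- `rank Y (x 0 ⊔ N)` and hence ignored by `ψ Y`.
    f x (suc i) = x (suc i ∸ lag (x 0))

    prefix : ∀ n {x y} → x ≈[ suc n ] y → f x ≈[ suc n ] f y
    prefix n         eq zero    _   = cong (_⊔ N) (eq 0 z<s)
    prefix n {x} {y} eq (suc i) i<n =
      trans (eq (suc i ∸ lag (x 0)) (≤-<-trans (m∸n≤m (suc i) (lag (x 0))) i<n))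
            (cong (λ k → y (suc i ∸ lag k)) (eq 0 z<s))

    ⊔-absorb : ∀ m n → N ≤ₙ m ⊔ n → (m ⊔ N) ⊔ (n ⊔ N) ≤ₙ m ⊔ n
    ⊔-absorb m n N≤ = ⊔-lub (⊔-lub (m≤m⊔n m n) N≤) (⊔-lub (m≤n⊔m m n) N≤)

    head : ∀ x y → f x 0 ≢ f y 0 → f x 0 ⊔ f y 0 ≤ₙ x 0 ⊔ y 0
    -- If both heads are below `N`, both images have head `N`; otherwise `x 0 ⊔ y 0` already bounds
    -- `N`.
    head x y neq with N ≤? x 0 | N ≤? y 0
    ... | yes N≤x | _ = ⊔-absorb (x 0) (y 0) (≤-trans N≤x (m≤m⊔n (x 0) (y 0)))
    ... | no _ | yes N≤y = ⊔-absorb (x 0) (y 0) (≤-trans N≤y (m≤n⊔m (x 0) (y 0)))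
    ... | no N≰x | no N≰y = contradiction
      (trans (m≤n⇒m⊔n≡n (<⇒≤ (≰⇒> N≰x))) (sym (m≤n⇒m⊔n≡n (<⇒≤ (≰⇒> N≰y))))) neq

    -- With `m` and `n` the ranks at target and source, the `i`-th coordinate read by `ψ Y` comes
    -- from the `i`-th one read by `ψ X`.
    undelay : ∀ {m n} i → n ≤ₙ m → suc (m + i) ∸ (m ∸ n) ≡ suc (n + i)
    undelay {m} {n} i n≤m = begin
      suc (m + i) ∸ (m ∸ n)              ≡⟨ cong (λ k → suc (k + i) ∸ (m ∸ n)) (m∸n+n≡m n≤m) ⟨
      suc (m ∸ n + n + i) ∸ (m ∸ n)      ≡⟨ cong (λ k → suc k ∸ (m ∸ n)) (+-assoc (m ∸ n) n i) ⟩
      suc (m ∸ n + (n + i)) ∸ (m ∸ n)    ≡⟨ cong (_∸ (m ∸ n)) (+-suc (m ∸ n) (n + i)) ⟨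
      m ∸ n + suc (n + i) ∸ (m ∸ n)      ≡⟨ m+n∸m≡n (m ∸ n) (suc (n + i)) ⟩
      suc (n + i)                        ∎
      where open ≡-Reasoning

    tail-f : ∀ x → tail Y (f x) ≗ tail X x
    tail-f x i = cong x (undelay i (rank-⊔ X Y N bound (x 0)))

-- A clopen self-dual set.

zeroHead : BaireSet
zeroHead = mkSet (λ x → x 0 ≡ 0) λ x≗y x≡0 → trans (sym (x≗y 0)) x≡0

zeroHead-𝚫⁰₁ : 𝚫⁰₁ zeroHead
zeroHead-𝚫⁰₁ =
  (λ x x≡0 → 1 , λ y eq → trans (sym (proj₁ (∷-injective eq))) x≡0) ,
  (λ x x≢0 → 1 , λ y eq y≡0 → x≢0 (trans (proj₁ (∷-injective eq)) y≡0))

zeroHead-selfDual : SelfDual W zeroHead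
zeroHead-selfDual = (λ x _ → flipHead (x 0)) ,
  W-head (λ n _ _ → flipHead n) (λ n → W-const _) ,
  (λ x → flipHead-dual (x 0))
  where
  flipHead-dual : ∀ n → n ≡ 0 ⇔ flipHead n ≢ 0
  flipHead-dual zero    = mk⇔ (λ _ ()) (λ _ → refl)
  flipHead-dual (suc n) = mk⇔ (λ ()) (λ 0≢0 → contradiction refl 0≢0)

-- An almost disjoint family indexed by binary sequences.

bit : Bool → ℕᵇ → ℕᵇ
bit true  = 2[1+_]
bit false = 1+[2_]

-- Bijective base two, with digits 2 and 1 for the bits, so that a numeral determines the initial
-- segment together with its length.
codeᵇ : (ℕ → Bool) → ℕ → ℕᵇ
codeᵇ a zero    = ℕᵇ.zero
codeᵇ a (suc k) = bit (a k) (codeᵇ a k)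

code : (ℕ → Bool) → ℕ → ℕ
code a k = toℕ (codeᵇ a k)

bit≢zero : ∀ c {x} → bit c x ≢ ℕᵇ.zero
bit≢zero true  ()
bit≢zero false ()

bit-injective : ∀ c c′ {x y} → bit c x ≡ bit c′ y → c ≡ c′ × x ≡ y
bit-injective true  true  refl = refl , refl
bit-injective false false refl = refl , refl
bit-injective true  false ()
bit-injective false true  ()

toℕ<toℕ-bit : ∀ c x → toℕ x < toℕ (bit c x)
toℕ<toℕ-bit true  x = m≤m+n (suc (toℕ x)) _
toℕ<toℕ-bit false x = s≤s (m≤m+n (toℕ x) _)

k≤code : ∀ a k → k ≤ₙ code a k
k≤code a zero    = z≤n
k≤code a (suc k) = ≤-<-trans (k≤code a k) (toℕ<toℕ-bit (a k) (codeᵇ a k))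

codeᵇ-injective : ∀ a b k l → codeᵇ a k ≡ codeᵇ b l → k ≡ l × (∀ i → i < k → a i ≡ b i)
codeᵇ-injective a b zero    zero    _  = refl , λ _ ()
codeᵇ-injective a b zero    (suc l) eq = contradiction (sym eq) (bit≢zero (b l))
codeᵇ-injective a b (suc k) zero    eq = contradiction eq (bit≢zero (a k))
codeᵇ-injective a b (suc k) (suc l) eq with bit-injective (a k) (b l) eq
... | ak≡bl , eq′ with codeᵇ-injective a b k l eq′
...   | refl , below = refl , λ { i (s≤s i≤k) → agree i (m≤n⇒m<n∨m≡n i≤k) }
  where
  agree : ∀ i → i < k ⊎ i ≡ k → a i ≡ b i
  agree i (inj₁ i<k)  = below i i<k
  agree i (inj₂ refl) = ak≡bl

branchCodes : (ℕ → Bool) → Pred ℕ 0ℓ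
branchCodes a n = ∃ λ k → n ≡ code a k

codeᵇ-cong : ∀ {a b} → a ≗ b → ∀ k → codeᵇ a k ≡ codeᵇ b k
codeᵇ-cong a≗b zero    = refl
codeᵇ-cong a≗b (suc k) = cong₂ bit (a≗b k) (codeᵇ-cong a≗b k)

branchCodes-cong : branchCodes Preserves _≗_ ⟶ _≐_
branchCodes-cong a≗b =
  (λ { (k , eq) → k , trans eq (cong toℕ (codeᵇ-cong a≗b k)) }) ,
  (λ { (k , eq) → k , trans eq (cong toℕ (sym (codeᵇ-cong a≗b k))) })

-- If the sequences differ at `i`, no code of a segment of `a` longer than `i` is a code for `b`,
-- and these codes are unbounded.
branchCodes-⊆* : ∀ {a b} → branchCodes a ⊆* branchCodes b → a ≗ b
branchCodes-⊆* {a} {b} a⊆*b i = decidable-stable (a i ≟ᵇ b i) λ ai≢bi →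
  unbounded⇒¬⊆* (λ k → code a (suc i + k) ,
    ≤-trans (m≤n+m k (suc i)) (k≤code a (suc i + k)) ,
    (suc i + k , refl) ,
    λ { (l , eq) → ai≢bi
          (proj₂ (codeᵇ-injective a b (suc i + k) l (toℕ-injective eq)) i (m≤m+n (suc i) k)) })
    a⊆*b

-- A strictly decreasing chain modulo finite.

multiples : ℕ → Pred ℕ 0ℓ
multiples m k = m ∣ k

2^-multiples-antitone : ∀ n → multiples (2 ^ₙ suc n) ⊆* multiples (2 ^ₙ n)
2^-multiples-antitone n = [] , λ { (div , ∤) → contradiction (∣-trans (n∣m*n 2) div) ∤ }

2^-multiples-strict : ∀ n → ¬ multiples (2 ^ₙ n) ⊆* multiples (2 ^ₙ suc n)
2^-multiples-strict n = unbounded⇒¬⊆* λ k →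
  -- Odd multiples of `2 ^ₙ n` escape the next set, and this one is at least `k`.
  2 ^ₙ n * (2 * k + 1) ,
  ≤-trans (m≤m+n k (1 * k))
    (≤-trans (m≤m+n (2 * k) 1) (m≤n*m (2 * k + 1) (2 ^ₙ n) {{m^n≢0 2 n}})) ,
  m∣m*n (2 * k + 1) ,
  λ div → 2∤odd k (*-cancelˡ-∣ (2 ^ₙ n) {{m^n≢0 2 n}}
    (subst (_∣ 2 ^ₙ n * (2 * k + 1)) (*-comm 2 (2 ^ₙ n)) div))
  where
  2∤odd : ∀ k → ¬ 2 ∣ 2 * k + 1
  2∤odd k 2∣odd with ∣1⇒≡1 (∣m+n∣m⇒∣n 2∣odd (m∣m*n k))
  ... | ()

-- The embedding, the antichain and the descending chain.

theorem5p11 : (em : ExcludedMiddle) → DependentChoice →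
    let open Metric em in
    ((A : BaireSet) → SelfDual W A →
    Σ[ ψ ∈ (Pred ℕ 0ℓ → BaireSet) ]
    (ψ Preserves _≐_ ⟶ _≐ᴮ_)
    × (∀ X → ψ X ∈ Degree W A)
    × (∀ X Y → X ⊆* Y ⇔ ψ X ≤[ L ] ψ Y))
    × (Σ[ ψ ∈ (Pred ℕ 0ℓ → BaireSet) ]
    (ψ Preserves _≐_ ⟶ _≐ᴮ_)
    × (∀ X → ψ X ∈ 𝚫⁰₁)
    × (∀ X Y → X ⊆* Y ⇔ ψ X ≤[ L ] ψ Y))
    × (Σ[ φ ∈ ((ℕ → Bool) → BaireSet) ]
    (φ Preserves _≗_ ⟶ _≐ᴮ_)
    × (∀ a → φ a ∈ 𝚫⁰₁)
    × (∀ a b → φ a ≐ᴮ φ b → a ≗ b)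
    × (∀ a b → ¬ (a ≗ b) → ¬ (φ a ≤[ L ] φ b) × ¬ (φ b ≤[ L ] φ a)))
    × (Σ[ c ∈ (ℕ → BaireSet) ]
    (∀ n → c n ∈ 𝚫⁰₁)
    × (∀ n → c (suc n) ≤[ L ] c n × ¬ (c n ≤[ L ] c (suc n))))
theorem5p11 em _ =
  (λ A (h , wh , dual) → let module E = Embedding em A h wh dual in
    E.ψ , E.ψ-cong , E.ψ-degree , λ _ _ → mk⇔ E.ψ-preserves E.ψ-reflects) ,
  (ψ , ψ-cong , ψ-𝚫⁰₁ , λ _ _ → mk⇔ ψ-preserves ψ-reflects) ,
  ( ψ ∘ branchCodes
  , (λ a≗b → ψ-cong (branchCodes-cong a≗b))
  , (λ a → ψ-𝚫⁰₁ (branchCodes a))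
  , (λ a b eq → branchCodes-⊆* (ψ-reflects (≐ᴮ⇒≤[L] em (ψ (branchCodes a)) (ψ (branchCodes b)) eq)))
  , λ a b a≢b → (a≢b ∘ branchCodes-⊆* ∘ ψ-reflects)
              , λ b≤a → a≢b (sym ∘ branchCodes-⊆* (ψ-reflects b≤a))) ,
  ( ψ ∘ multiples ∘ (2 ^ₙ_)
  , (λ n → ψ-𝚫⁰₁ (multiples (2 ^ₙ n)))
  , λ n → ψ-preserves (2^-multiples-antitone n) , 2^-multiples-strict n ∘ ψ-reflects)
  where
  open Embedding em zeroHead (proj₁ zeroHead-selfDual) (proj₁ (proj₂ zeroHead-selfDual))
                 (proj₂ (proj₂ zeroHead-selfDual))

  -- Clopenness passes down Wadge reductions, here from `zeroHead`.
  ψ-𝚫⁰₁ : ∀ X → ψ X ∈ 𝚫⁰₁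
  ψ-𝚫⁰₁ X = 𝚫⁰₁-≤W {zeroHead} {ψ X} (proj₁ (ψ-degree X)) zeroHead-𝚫⁰₁
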